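{- Let $r$ and $s$ be arbitrary integer parameters. The three integers $$a = r^2(r^2+s^2)(r^8 + 2r^6s^2 - 12r^4s^4 - 6r^2s^6 - s^8)^2(r^{12} + 6r^{10}s^2 + 87r^8s^4 + 108r^6s^6 + 55r^4s^8 + 14r^2s^{10} + s^{12}),$$ $$b = s^2(r^2+s^2)(5r^6 + 3r^4s^2 + 3r^2s^4 + s^6)^2(r^8 + 2r^6s^2 - 12r^4s^4 - 6r^2s^6 - s^8)^2,$$ $$c = 4r^4s^4(5r^6 + 3r^4s^2 + 3r^2s^4 + s^6)^2(r^{12} + 6r^{10}s^2 + 87r^8s^4 + 108r^6s^6 + 55r^4s^8 + 14r^2s^{10} + s^{12})$$ are such that $a+b+c$, $ab+bc+ca$ and $abc$ are all perfect squares. This is a parametric solution, given by polynomials of degree 32, in which none of the three integers $a,b,c$ is a square, and all three integers are sums of two nonzero squares.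
   Context: A perfect square (or square) is the square of an integer; "sums of two nonzero squares" refers to squares of rational numbers. The problem being solved is that of finding three integers $a,b,c$ whose elementary symmetric functions $a+b+c$, $ab+bc+ca$, $abc$ are all perfect squares.
   Formalization: "None of a, b, c is a square" is stated for a, b, c as polynomials in r, s, since for integer values it can fail (b is a square at r=3, s=4); "sums of two nonzero squares" is stated for nonzero r and s, since some of a, b, c vanish otherwise. -}

module Defs where

open import Algebra.Bundles.Raw using (RawRing)
import Algebra.Definitions.RawSemiring as RawSemiringDefs
open import Data.Integer.Base using (ℤ; 0ℤ; +-*-rawRing)
open import Data.List.Base using (List; []; _∷_; map)
open import Data.Nat.Base as ℕ using (ℕ; zero; suc)
open import Data.Product.Base using (_×_; ∃₂; ∃-syntax)
open import Data.Rational.Base as ℚ using (ℚ; 0ℚ)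
open import Relation.Binary.PropositionalEquality.Core using (_≡_; _≢_)

module _ {c ℓ} (R : RawRing c ℓ) where
  open RawRing R

  IsSquare : Carrier → Set _
  IsSquare x = ∃[ y ] x ≈ y * y

-- The degree-32 forms, over an arbitrary ring of values for r and s. They are
-- used both at integers and at the two indeterminates of ℤ[r,s]. Here n · x is
-- the n-fold sum of x, which expresses the integer coefficients in any ring.
module Forms {c ℓ} (R : RawRing c ℓ) (r s : RawRing.Carrier R) where
  open RawRing R
  open RawSemiringDefs rawSemiring using (_^_) renaming (_×_ to _·_)

  infixl 6 _-_
  _-_ : Carrier → Carrier → Carrier
  x - y = x + (- y)

  p₆ p₈ p₁₂ : Carrier
  p₆ = 5 · r ^ 6 + 3 · (r ^ 4 * s ^ 2) + 3 · (r ^ 2 * s ^ 4) + s ^ 6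
  p₈ = r ^ 8 + 2 · (r ^ 6 * s ^ 2) - 12 · (r ^ 4 * s ^ 4) - 6 · (r ^ 2 * s ^ 6) - s ^ 8
  p₁₂ = r ^ 12 + 6 · (r ^ 10 * s ^ 2) + 87 · (r ^ 8 * s ^ 4) + 108 · (r ^ 6 * s ^ 6)
        + 55 · (r ^ 4 * s ^ 8) + 14 · (r ^ 2 * s ^ 10) + s ^ 12

  formA formB formC : Carrier
  formA = r ^ 2 * (r ^ 2 + s ^ 2) * p₈ ^ 2 * p₁₂
  formB = s ^ 2 * (r ^ 2 + s ^ 2) * p₆ ^ 2 * p₈ ^ 2
  formC = 4 · (r ^ 4 * s ^ 4 * p₆ ^ 2 * p₁₂)

-- R[x] as coefficient lists, constant term first. Trailing zeros are allowed,
-- so equality compares coefficients rather than lists.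
module Polynomial {c ℓ} (R : RawRing c ℓ) where
  open RawRing R

  coeff : List Carrier → ℕ → Carrier
  coeff []      _       = 0#
  coeff (a ∷ _) zero    = a
  coeff (_ ∷ p) (suc n) = coeff p n

  add : List Carrier → List Carrier → List Carrier
  add []      q       = q
  add (a ∷ p) []      = a ∷ p
  add (a ∷ p) (b ∷ q) = a + b ∷ add p q

  mul : List Carrier → List Carrier → List Carrier
  mul []      _ = []
  mul (a ∷ p) q = add (map (a *_) q) (0# ∷ mul p q)

  eval : List Carrier → Carrier → Carrier
  eval []      _ = 0#
  eval (a ∷ p) x = a + x * eval p x

  X : List Carrier
  X = 0# ∷ 1# ∷ []

  rawRing : RawRing c ℓ
  rawRing = record
    { Carrier = List Carrier
    ; _≈_     = λ p q → ∀ n → coeff p n ≈ coeff q n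
    ; _+_     = add
    ; _*_     = mul
    ; -_      = map -_
    ; 0#      = []
    ; 1#      = 1# ∷ []
    }

-- ℤ[r,s] is represented as (ℤ[r])[s].
private
  module ℤ[r]    = Polynomial +-*-rawRing
  module ℤ[r][s] = Polynomial ℤ[r].rawRing

ℤ[r,s] : RawRing _ _
ℤ[r,s] = ℤ[r][s].rawRing

Poly : Set
Poly = RawRing.Carrier ℤ[r,s]

𝐫 𝐬 : Poly
𝐫 = ℤ[r].X ∷ []
𝐬 = ℤ[r][s].X

coeff₂ : Poly → ℕ → ℕ → ℤ
coeff₂ p i j = ℤ[r].coeff (ℤ[r][s].coeff p j) i

eval₂ : Poly → ℤ → ℤ → ℤ
eval₂ p r s = ℤ[r].eval (map (λ q → ℤ[r].eval q r) p) s

HasTotalDegree : Poly → ℕ → Set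
HasTotalDegree p d =
  (∀ i j → d ℕ.< i ℕ.+ j → coeff₂ p i j ≡ 0ℤ) ×
  (∃₂ λ i j → i ℕ.+ j ≡ d × coeff₂ p i j ≢ 0ℤ)

open Forms +-*-rawRing public using () renaming (formA to a; formB to b; formC to c)
open Forms ℤ[r,s] 𝐫 𝐬 public using () renaming (formA to polyA; formB to polyB; formC to polyC)

SumOfTwoNonzeroSquares : ℤ → Set
SumOfTwoNonzeroSquares n =
  ∃₂ λ (x y : ℚ) → x ≢ 0ℚ × y ≢ 0ℚ × n ℚ./ 1 ≡ x ℚ.* x ℚ.+ y ℚ.* y

{-# OPTIONS --safe #-}
module Submission where

-- Put w = r² + s². Then w p₈² + 4 r² s⁴ p₆² + 4 r⁴ s² p₁₂ = w³ p₁₂, so ab + bc + ca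
-- is the square of r s w² p₆ p₈ p₁₂, while abc is visibly a square and a + b + c is
-- the square of a form of degree 16. As p₁₂ is a sum of two squares of forms, so are
-- a, b and c; one of the two squares is nonzero because w, p₆ and p₈ have no zero
-- modulo 7 except r ≡ s ≡ 0, and x² = (3x/5)² + (4x/5)² if the other one vanishes.
-- At r = s = 1 none of a, b, c is a square, so they are not squares of polynomials.

open import Defs
open import Algebra.Bundles.Raw using (RawRing)
import Algebra.Definitions.RawSemiring as RawSemiringDefs
open import Algebra.Morphism.Structures using (module RingMorphisms)
open import Data.Empty using (⊥-elim)
open import Data.Fin.Base as Fin using (Fin)
import Data.Fin.Properties as Fin
open import Data.Integer.Base using (ℤ; 0ℤ; 1ℤ; +_; -_; ∣_∣; _%ℕ_; _/ℕ_; _+_; _*_; +-*-rawRing)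
open import Data.Integer.DivMod using (n%ℕd<d; a≡a%ℕn+[a/ℕn]*n)
open import Data.Integer.Divisibility.Signed
  using (_∣_; divides; _∣?_; ∣m∣n⇒∣m+n; ∣m⇒∣-m; ∣n⇒∣m*n; ∣m⇒∣m*n)
open import Data.Integer.Properties as ℤ using (_≟_)
open import Data.Integer.Tactic.RingSolver using (ring; solve-∀)
open import Data.List.Base using (List; []; _∷_; map)
open import Data.List.Properties using (≡-dec)
open import Data.Nat.Base as ℕ using (ℕ; zero; suc; z≤n; s≤s)
open import Data.Nat.Induction using (<-wellFounded)
import Data.Nat.Properties as ℕ
open import Data.Product.Base using (_×_; _,_; proj₁; proj₂)
open import Data.Rational.Base as ℚ using (0ℚ; toℚᵘ)
import Data.Rational.Properties as ℚ
open import Data.Rational.Unnormalised.Base as ℚᵘ using (mkℚᵘ; *≡*; _≃_)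
import Data.Rational.Unnormalised.Properties as ℚᵘ
open import Data.Sum.Base using ([_,_]′)
open import Data.Unit.Base using (⊤; tt)
open import Data.Vec.Base as Vec using (Vec; []; _∷_; lookup)
open import Data.Vec.Properties using (lookup-map)
open import Function.Base using (id; _∘_)
open import Induction.WellFounded using (Acc; acc)
open import Level using (Level)
open import Relation.Binary.PropositionalEquality
  using (_≡_; _≢_; refl; sym; trans; cong; cong₂; subst; subst₂; module ≡-Reasoning)
open import Relation.Nullary.Decidable using (Dec; yes; no; _×-dec_; _→-dec_; True; toWitness)
open import Relation.Nullary.Negation.Core using (¬_)
open import Tactic.RingSolver.Core.Expression using (Expr; Κ; Ι; _⊕_; _⊗_; _⊛_; ⊝_)
open import Tactic.RingSolver.NonReflective ring using (module Ops)
open Ops using (norm; ⟦_⟧; prove; homo)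
open RawSemiringDefs (RawRing.rawSemiring +-*-rawRing) using (_^′_)
open import Tactic.RingSolver.Core.Polynomial.Semantics homo using () renaming (⟦_⟧ to ⟦_⟧ₚ)

private
  variable
    c′ ℓ : Level

-- Homomorphisms into ℤ

IsHom : (R : RawRing c′ ℓ) → (RawRing.Carrier R → ℤ) → Set _
IsHom R = RingMorphisms.IsRingHomomorphism R +-*-rawRing

module _ (R : RawRing c′ ℓ) {h : RawRing.Carrier R → ℤ} where
  private module R = RawRing R

  isHom : (∀ {x y} → x R.≈ y → h x ≡ h y) →
          (∀ x y → h (x R.+ y) ≡ h x + h y) → (∀ x y → h (x R.* y) ≡ h x * h y) →
          (∀ x → h (R.- x) ≡ - h x) → h R.0# ≡ 0ℤ → h R.1# ≡ 1ℤ → IsHom R h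
  isHom h-cong h-+ h-* h-neg h-0 h-1 = record
    { isSemiringHomomorphism = record
      { isNearSemiringHomomorphism = record
        { +-isMonoidHomomorphism = record
          { isMagmaHomomorphism = record
            { isRelHomomorphism = record { cong = h-cong }
            ; homo = h-+
            }
          ; ε-homo = h-0
          }
        ; *-homo = h-*
        }
      ; 1#-homo = h-1
      }
    ; -‿homo = h-neg
    }

module FormsHom (R : RawRing c′ ℓ) {h : RawRing.Carrier R → ℤ} (hom : IsHom R h) where
  private
    module R = RawRing R
    open RingMorphisms.IsRingHomomorphism hom
    open RawSemiringDefs R.rawSemiring using () renaming (_^_ to _^ᴿ_; _×_ to _·ᴿ_)
    open RawSemiringDefs (RawRing.rawSemiring +-*-rawRing) using (_^_) renaming (_×_ to _·_)

  infix  4 _↦_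
  infixl 6 _⟨+⟩_ _⟨-⟩_
  infixl 7 _⟨*⟩_
  infixr 8 _⟨^⟩_ _⟨·⟩_

  record _↦_ (x : R.Carrier) (i : ℤ) : Set where
    constructor mk
    field image : h x ≡ i
  open _↦_ public

  _⟨+⟩_ : ∀ {x y i j} → x ↦ i → y ↦ j → x R.+ y ↦ i + j
  mk p ⟨+⟩ mk q = mk (trans (+-homo _ _) (cong₂ _+_ p q))

  _⟨*⟩_ : ∀ {x y i j} → x ↦ i → y ↦ j → x R.* y ↦ i * j
  mk p ⟨*⟩ mk q = mk (trans (*-homo _ _) (cong₂ _*_ p q))

  _⟨-⟩_ : ∀ {x y i j} → x ↦ i → y ↦ j → x R.+ (R.- y) ↦ i + (- j)
  mk p ⟨-⟩ mk q = mk p ⟨+⟩ mk (trans (-‿homo _) (cong -_ q))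

  _⟨^⟩_ : ∀ {x i} → x ↦ i → ∀ n → x ^ᴿ n ↦ i ^ n
  p ⟨^⟩ zero  = mk 1#-homo
  p ⟨^⟩ suc n = p ⟨*⟩ (p ⟨^⟩ n)

  _⟨·⟩_ : ∀ n {x i} → x ↦ i → n ·ᴿ x ↦ n · i
  zero  ⟨·⟩ p = mk 0#-homo
  suc n ⟨·⟩ p = p ⟨+⟩ (n ⟨·⟩ p)

  module _ (x y : R.Carrier) {i j : ℤ} (hx : h x ≡ i) (hy : h y ≡ j) where
    private
      module R[x,y] = Forms R x y
      module ℤ[i,j] = Forms +-*-rawRing i j

      r : x ↦ i
      r = mk hx

      s : y ↦ j
      s = mk hy

      p₆ : R[x,y].p₆ ↦ ℤ[i,j].p₆
      p₆ = 5 ⟨·⟩ (r ⟨^⟩ 6) ⟨+⟩ 3 ⟨·⟩ (r ⟨^⟩ 4 ⟨*⟩ s ⟨^⟩ 2) ⟨+⟩ 3 ⟨·⟩ (r ⟨^⟩ 2 ⟨*⟩ s ⟨^⟩ 4) ⟨+⟩ s ⟨^⟩ 6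

      p₈ : R[x,y].p₈ ↦ ℤ[i,j].p₈
      p₈ = r ⟨^⟩ 8 ⟨+⟩ 2 ⟨·⟩ (r ⟨^⟩ 6 ⟨*⟩ s ⟨^⟩ 2) ⟨-⟩ 12 ⟨·⟩ (r ⟨^⟩ 4 ⟨*⟩ s ⟨^⟩ 4)
           ⟨-⟩ 6 ⟨·⟩ (r ⟨^⟩ 2 ⟨*⟩ s ⟨^⟩ 6) ⟨-⟩ s ⟨^⟩ 8

      p₁₂ : R[x,y].p₁₂ ↦ ℤ[i,j].p₁₂
      p₁₂ = r ⟨^⟩ 12 ⟨+⟩ 6 ⟨·⟩ (r ⟨^⟩ 10 ⟨*⟩ s ⟨^⟩ 2) ⟨+⟩ 87 ⟨·⟩ (r ⟨^⟩ 8 ⟨*⟩ s ⟨^⟩ 4)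
            ⟨+⟩ 108 ⟨·⟩ (r ⟨^⟩ 6 ⟨*⟩ s ⟨^⟩ 6) ⟨+⟩ 55 ⟨·⟩ (r ⟨^⟩ 4 ⟨*⟩ s ⟨^⟩ 8)
            ⟨+⟩ 14 ⟨·⟩ (r ⟨^⟩ 2 ⟨*⟩ s ⟨^⟩ 10) ⟨+⟩ s ⟨^⟩ 12

    formA-homo : Forms.formA R x y ↦ a i j
    formA-homo = r ⟨^⟩ 2 ⟨*⟩ (r ⟨^⟩ 2 ⟨+⟩ s ⟨^⟩ 2) ⟨*⟩ p₈ ⟨^⟩ 2 ⟨*⟩ p₁₂

    formB-homo : Forms.formB R x y ↦ b i j
    formB-homo = s ⟨^⟩ 2 ⟨*⟩ (r ⟨^⟩ 2 ⟨+⟩ s ⟨^⟩ 2) ⟨*⟩ p₆ ⟨^⟩ 2 ⟨*⟩ p₈ ⟨^⟩ 2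

    formC-homo : Forms.formC R x y ↦ c i j
    formC-homo = 4 ⟨·⟩ (r ⟨^⟩ 4 ⟨*⟩ s ⟨^⟩ 4 ⟨*⟩ p₆ ⟨^⟩ 2 ⟨*⟩ p₁₂)

-- Evaluation of polynomials

module Evaluation (R : RawRing c′ ℓ) {h : RawRing.Carrier R → ℤ} (hom : IsHom R h) (x : ℤ)
  {φ : List (RawRing.Carrier R) → ℤ} (φ-[] : φ [] ≡ 0ℤ) (φ-∷ : ∀ k p → φ (k ∷ p) ≡ h k + x * φ p) where

  private
    module R = RawRing R
    open RingMorphisms.IsRingHomomorphism hom
    open Polynomial R hiding (eval)
    open ≡-Reasoning

    φ-add : ∀ p q → φ (add p q) ≡ φ p + φ q
    φ-add []      q       = sym (trans (cong (_+ φ q) φ-[]) (ℤ.+-identityˡ _))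
    φ-add (k ∷ p) []      = sym (trans (cong (_+_ (φ (k ∷ p))) φ-[]) (ℤ.+-identityʳ _))
    φ-add (k ∷ p) (l ∷ q) = begin
      φ (k R.+ l ∷ add p q)                 ≡⟨ φ-∷ _ _ ⟩
      h (k R.+ l) + x * φ (add p q)         ≡⟨ cong₂ (λ m n → m + x * n) (+-homo k l) (φ-add p q) ⟩
      (h k + h l) + x * (φ p + φ q)         ≡⟨ rearrange (h k) (h l) x (φ p) (φ q) ⟩
      (h k + x * φ p) + (h l + x * φ q)     ≡⟨ cong₂ _+_ (φ-∷ k p) (φ-∷ l q) ⟨
      φ (k ∷ p) + φ (l ∷ q)                 ∎
      where
      rearrange : ∀ k l x p q → (k + l) + x * (p + q) ≡ (k + x * p) + (l + x * q)
      rearrange = solve-∀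

    φ-scale : ∀ k q → φ (map (k R.*_) q) ≡ h k * φ q
    φ-scale k []      = trans φ-[] (sym (trans (cong (h k *_) φ-[]) (ℤ.*-zeroʳ (h k))))
    φ-scale k (l ∷ q) = begin
      φ (k R.* l ∷ map (k R.*_) q)          ≡⟨ φ-∷ _ _ ⟩
      h (k R.* l) + x * φ (map (k R.*_) q)  ≡⟨ cong₂ (λ m n → m + x * n) (*-homo k l) (φ-scale k q) ⟩
      h k * h l + x * (h k * φ q)           ≡⟨ rearrange (h k) (h l) x (φ q) ⟩
      h k * (h l + x * φ q)                 ≡⟨ cong (h k *_) (φ-∷ l q) ⟨
      h k * φ (l ∷ q)                       ∎
      where
      rearrange : ∀ k l x q → k * l + x * (k * q) ≡ k * (l + x * q)
      rearrange = solve-∀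

    φ-mul : ∀ p q → φ (mul p q) ≡ φ p * φ q
    φ-mul []      q = trans φ-[] (sym (cong (_* φ q) φ-[]))
    φ-mul (k ∷ p) q = begin
      φ (add (map (k R.*_) q) (R.0# ∷ mul p q))          ≡⟨ φ-add (map (k R.*_) q) _ ⟩
      φ (map (k R.*_) q) + φ (R.0# ∷ mul p q)            ≡⟨ cong₂ _+_ (φ-scale k q) (φ-∷ _ _) ⟩
      h k * φ q + (h R.0# + x * φ (mul p q))             ≡⟨ cong₂ (λ m n → h k * φ q + (m + x * n)) 0#-homo (φ-mul p q) ⟩
      h k * φ q + (0ℤ + x * (φ p * φ q))                 ≡⟨ rearrange (h k) x (φ p) (φ q) ⟩
      (h k + x * φ p) * φ q                              ≡⟨ cong (_* φ q) (φ-∷ k p) ⟨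
      φ (k ∷ p) * φ q                                    ∎
      where
      rearrange : ∀ k x p q → k * q + (0ℤ + x * (p * q)) ≡ (k + x * p) * q
      rearrange = solve-∀

    φ-neg : ∀ p → φ (map R.-_ p) ≡ - φ p
    φ-neg []      = trans φ-[] (sym (cong -_ φ-[]))
    φ-neg (k ∷ p) = begin
      φ (R.- k ∷ map R.-_ p)            ≡⟨ φ-∷ _ _ ⟩
      h (R.- k) + x * φ (map R.-_ p)    ≡⟨ cong₂ (λ m n → m + x * n) (-‿homo k) (φ-neg p) ⟩
      - h k + x * - φ p                 ≡⟨ rearrange (h k) x (φ p) ⟩
      - (h k + x * φ p)                 ≡⟨ cong -_ (φ-∷ k p) ⟨
      - φ (k ∷ p)                       ∎
      where
      rearrange : ∀ k x p → - k + x * - p ≡ - (k + x * p)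
      rearrange = solve-∀

    φ-1 : φ (R.1# ∷ []) ≡ 1ℤ
    φ-1 = begin
      φ (R.1# ∷ [])       ≡⟨ φ-∷ _ _ ⟩
      h R.1# + x * φ []   ≡⟨ cong₂ (λ m n → m + x * n) 1#-homo φ-[] ⟩
      1ℤ + x * 0ℤ         ≡⟨ cong (_+_ 1ℤ) (ℤ.*-zeroʳ x) ⟩
      1ℤ                  ∎

    φ-zero : ∀ p → (∀ n → h (coeff p n) ≡ 0ℤ) → φ p ≡ 0ℤ
    φ-zero []      _  = φ-[]
    φ-zero (k ∷ p) p≈0 = begin
      φ (k ∷ p)       ≡⟨ φ-∷ k p ⟩
      h k + x * φ p   ≡⟨ cong₂ (λ m n → m + x * n) (p≈0 0) (φ-zero p (p≈0 ∘ suc)) ⟩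
      0ℤ + x * 0ℤ     ≡⟨ cong (_+_ 0ℤ) (ℤ.*-zeroʳ x) ⟩
      0ℤ              ∎

    φ-cong : ∀ p q → (∀ n → h (coeff p n) ≡ h (coeff q n)) → φ p ≡ φ q
    φ-cong []      q       p≈q = trans φ-[] (sym (φ-zero q λ n → trans (sym (p≈q n)) 0#-homo))
    φ-cong (k ∷ p) []      p≈q = trans (φ-zero (k ∷ p) λ n → trans (p≈q n) 0#-homo) (sym φ-[])
    φ-cong (k ∷ p) (l ∷ q) p≈q = begin
      φ (k ∷ p)       ≡⟨ φ-∷ k p ⟩
      h k + x * φ p   ≡⟨ cong₂ (λ m n → m + x * n) (p≈q 0) (φ-cong p q (p≈q ∘ suc)) ⟩
      h l + x * φ q   ≡⟨ φ-∷ l q ⟨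
      φ (l ∷ q)       ∎

  φ-isHom : IsHom rawRing φ
  φ-isHom = isHom rawRing (λ {p} {q} p≈q → φ-cong p q λ n → ⟦⟧-cong (p≈q n))
    φ-add φ-mul φ-neg φ-[] φ-1

module _ (r s : ℤ) where
  private
    eval-isHom : IsHom (Polynomial.rawRing +-*-rawRing) (λ p → Polynomial.eval +-*-rawRing p r)
    eval-isHom = Evaluation.φ-isHom +-*-rawRing
      (isHom +-*-rawRing id (λ _ _ → refl) (λ _ _ → refl) (λ _ → refl) refl refl)
      r refl (λ _ _ → refl)

  eval₂-isHom : IsHom ℤ[r,s] (λ p → eval₂ p r s)
  eval₂-isHom = Evaluation.φ-isHom (Polynomial.rawRing +-*-rawRing) eval-isHom s refl (λ _ _ → refl)

  private
    eval₂-𝐫 : eval₂ 𝐫 r s ≡ r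
    eval₂-𝐫 = computed r s
      where
      computed : ∀ r s → (0ℤ + r * (1ℤ + r * 0ℤ)) + s * 0ℤ ≡ r
      computed = solve-∀

    eval₂-𝐬 : eval₂ 𝐬 r s ≡ s
    eval₂-𝐬 = computed r s
      where
      computed : ∀ r s → 0ℤ + s * ((1ℤ + r * 0ℤ) + s * 0ℤ) ≡ s
      computed = solve-∀

  eval₂-formA : eval₂ (Forms.formA ℤ[r,s] 𝐫 𝐬) r s ≡ a r s
  eval₂-formA =
    let FormsHom.mk eq = FormsHom.formA-homo ℤ[r,s] eval₂-isHom 𝐫 𝐬 {r} {s} eval₂-𝐫 eval₂-𝐬 in eq

  eval₂-formB : eval₂ (Forms.formB ℤ[r,s] 𝐫 𝐬) r s ≡ b r s
  eval₂-formB =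
    let FormsHom.mk eq = FormsHom.formB-homo ℤ[r,s] eval₂-isHom 𝐫 𝐬 {r} {s} eval₂-𝐫 eval₂-𝐬 in eq

  eval₂-formC : eval₂ (Forms.formC ℤ[r,s] 𝐫 𝐬) r s ≡ c r s
  eval₂-formC =
    let FormsHom.mk eq = FormsHom.formC-homo ℤ[r,s] eval₂-isHom 𝐫 𝐬 {r} {s} eval₂-𝐫 eval₂-𝐬 in eq

-- Agda unfolds the names polyA, polyB and polyC (copies from an applied module)
-- in terms but not in signatures, and comparing the two versions normalises the
-- polynomials, which is infeasible. Under a variable P the underscore is solved
-- by the folded name, and True evaluates the equality test efficiently.
private
  atPolyA : (P : Poly → Set) → (∀ p → P p) → P polyA
  atPolyA P h = h _

  atPolyB : (P : Poly → Set) → (∀ p → P p) → P polyB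
  atPolyB P h = h _

  atPolyC : (P : Poly → Set) → (∀ p → P p) → P polyC
  atPolyC P h = h _

  _≡?_ : (p q : Poly) → Dec (p ≡ q)
  _≡?_ = ≡-dec (≡-dec _≟_)

  subst-by-computation : (P : Poly → Set) (p : Poly) → P p → ∀ q → True (p ≡? q) → P q
  subst-by-computation P p h q p≡q = subst P (toWitness p≡q) h

formA⇒polyA : (P : Poly → Set) → P (Forms.formA ℤ[r,s] 𝐫 𝐬) → P polyA
formA⇒polyA P h =
  atPolyA (λ p → True (Forms.formA ℤ[r,s] 𝐫 𝐬 ≡? p) → P p) (subst-by-computation P (Forms.formA ℤ[r,s] 𝐫 𝐬) h) tt

formB⇒polyB : (P : Poly → Set) → P (Forms.formB ℤ[r,s] 𝐫 𝐬) → P polyB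
formB⇒polyB P h =
  atPolyB (λ p → True (Forms.formB ℤ[r,s] 𝐫 𝐬 ≡? p) → P p) (subst-by-computation P (Forms.formB ℤ[r,s] 𝐫 𝐬) h) tt

formC⇒polyC : (P : Poly → Set) → P (Forms.formC ℤ[r,s] 𝐫 𝐬) → P polyC
formC⇒polyC P h =
  atPolyC (λ p → True (Forms.formC ℤ[r,s] 𝐫 𝐬 ≡? p) → P p) (subst-by-computation P (Forms.formC ℤ[r,s] 𝐫 𝐬) h) tt

eval₂-polyA : ∀ r s → eval₂ polyA r s ≡ a r s
eval₂-polyA r s = formA⇒polyA (λ p → eval₂ p r s ≡ a r s) (eval₂-formA r s)

eval₂-polyB : ∀ r s → eval₂ polyB r s ≡ b r s
eval₂-polyB r s = formB⇒polyB (λ p → eval₂ p r s ≡ b r s) (eval₂-formB r s)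

eval₂-polyC : ∀ r s → eval₂ polyC r s ≡ c r s
eval₂-polyC r s = formC⇒polyC (λ p → eval₂ p r s ≡ c r s) (eval₂-formC r s)

-- Nonsquares

eval₂-square : ∀ p → IsSquare ℤ[r,s] p → ∀ r s → IsSquare +-*-rawRing (eval₂ p r s)
eval₂-square p (y , p≈y²) r s = eval₂ y r s , trans (⟦⟧-cong {p} {RawRing._*_ ℤ[r,s] y y} p≈y²) (*-homo y y)
  where open RingMorphisms.IsRingHomomorphism (eval₂-isHom r s)

nonsquare : ∀ k {n} → k ℕ.* k ℕ.< n → n ℕ.< suc k ℕ.* suc k → ¬ IsSquare +-*-rawRing (+ n)
nonsquare k {n} k²<n n<[1+k]² (y , n≡y²) with ∣ y ∣ ℕ.≤? k | trans (cong ∣_∣ n≡y²) (ℤ.abs-* y y)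
... | yes y≤k | ∣n∣≡∣y∣² = ℕ.<⇒≱ k²<n (subst (ℕ._≤ k ℕ.* k) (sym ∣n∣≡∣y∣²) (ℕ.*-mono-≤ y≤k y≤k))
... | no  y≰k | ∣n∣≡∣y∣² =
  ℕ.<⇒≱ n<[1+k]² (subst (suc k ℕ.* suc k ℕ.≤_) (sym ∣n∣≡∣y∣²) (ℕ.*-mono-≤ (ℕ.≰⇒> y≰k) (ℕ.≰⇒> y≰k)))

nonsquare-poly : ∀ p k n → eval₂ p 1ℤ 1ℤ ≡ + n → k ℕ.* k ℕ.< n → n ℕ.< suc k ℕ.* suc k →
                 ¬ IsSquare ℤ[r,s] p
nonsquare-poly p k n p[1,1]≡n k²<n n<[1+k]² p-square =
  nonsquare k k²<n n<[1+k]² (subst (IsSquare +-*-rawRing) p[1,1]≡n (eval₂-square p p-square 1ℤ 1ℤ))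

polyA-nonsquare : ¬ IsSquare ℤ[r,s] polyA
polyA-nonsquare = formA⇒polyA (λ p → ¬ IsSquare ℤ[r,s] p)
  (nonsquare-poly (Forms.formA ℤ[r,s] 𝐫 𝐬) 373 139264 (eval₂-formA 1ℤ 1ℤ)
    (toWitness {a? = _ ℕ.<? _} tt) (toWitness {a? = _ ℕ.<? _} tt))

polyB-nonsquare : ¬ IsSquare ℤ[r,s] polyB
polyB-nonsquare = formB⇒polyB (λ p → ¬ IsSquare ℤ[r,s] p)
  (nonsquare-poly (Forms.formB ℤ[r,s] 𝐫 𝐬) 271 73728 (eval₂-formB 1ℤ 1ℤ)
    (toWitness {a? = _ ℕ.<? _} tt) (toWitness {a? = _ ℕ.<? _} tt))

polyC-nonsquare : ¬ IsSquare ℤ[r,s] polyC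
polyC-nonsquare = formC⇒polyC (λ p → ¬ IsSquare ℤ[r,s] p)
  (nonsquare-poly (Forms.formC ℤ[r,s] 𝐫 𝐬) 395 156672 (eval₂-formC 1ℤ 1ℤ)
    (toWitness {a? = _ ℕ.<? _} tt) (toWitness {a? = _ ℕ.<? _} tt))

-- Total degree

VanishesFrom : ℕ → List ℤ → Set
VanishesFrom _       []      = ⊤
VanishesFrom zero    (k ∷ p) = k ≡ 0ℤ × VanishesFrom zero p
VanishesFrom (suc n) (_ ∷ p) = VanishesFrom n p

vanishesFrom? : ∀ n p → Dec (VanishesFrom n p)
vanishesFrom? _       []      = yes tt
vanishesFrom? zero    (k ∷ p) = k ≟ 0ℤ ×-dec vanishesFrom? zero p
vanishesFrom? (suc n) (_ ∷ p) = vanishesFrom? n p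

vanishesFrom-coeff : ∀ {n} p → VanishesFrom n p → ∀ i → n ℕ.≤ i →
                     Polynomial.coeff +-*-rawRing p i ≡ 0ℤ
vanishesFrom-coeff         []      _         _       _         = refl
vanishesFrom-coeff {zero}  (k ∷ p) (k≡0 , _) zero    _         = k≡0
vanishesFrom-coeff {zero}  (k ∷ p) (_ , p≡0) (suc i) _         = vanishesFrom-coeff p p≡0 i z≤n
vanishesFrom-coeff {suc n} (k ∷ p) p≡0       (suc i) (s≤s n≤i) = vanishesFrom-coeff p p≡0 i n≤i

VanishesFromDegree : ℕ → Poly → Set
VanishesFromDegree _ []      = ⊤
VanishesFromDegree n (q ∷ p) = VanishesFrom n q × VanishesFromDegree (ℕ.pred n) p

vanishesFromDegree? : ∀ n p → Dec (VanishesFromDegree n p)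
vanishesFromDegree? _ []      = yes tt
vanishesFromDegree? n (q ∷ p) = vanishesFrom? n q ×-dec vanishesFromDegree? (ℕ.pred n) p

vanishesFromDegree-coeff₂ : ∀ {n} p → VanishesFromDegree n p → ∀ i j → n ℕ.≤ i ℕ.+ j → coeff₂ p i j ≡ 0ℤ
vanishesFromDegree-coeff₂     []      _         i j       n≤ = refl
vanishesFromDegree-coeff₂ {n} (q ∷ p) (q≡0 , _) i zero    n≤ =
  vanishesFrom-coeff q q≡0 i (subst (n ℕ.≤_) (ℕ.+-identityʳ i) n≤)
vanishesFromDegree-coeff₂ {n} (q ∷ p) (_ , p≡0) i (suc j) n≤ =
  vanishesFromDegree-coeff₂ p p≡0 i j (ℕ.pred-mono-≤ (subst (n ℕ.≤_) (ℕ.+-suc i j) n≤))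

hasTotalDegree : ∀ p d → True (vanishesFromDegree? (suc d) p) →
                 ∀ i j → i ℕ.+ j ≡ d → coeff₂ p i j ≢ 0ℤ → HasTotalDegree p d
hasTotalDegree p d p≡0 i j i+j≡d pᵢⱼ≢0 =
  vanishesFromDegree-coeff₂ p (toWitness p≡0) , i , j , i+j≡d , pᵢⱼ≢0

polyA-degree : HasTotalDegree polyA 32
polyA-degree = formA⇒polyA (λ p → HasTotalDegree p 32)
  (hasTotalDegree (Forms.formA ℤ[r,s] 𝐫 𝐬) 32 tt 32 0 refl λ ())

polyB-degree : HasTotalDegree polyB 32
polyB-degree = formB⇒polyB (λ p → HasTotalDegree p 32)
  (hasTotalDegree (Forms.formB ℤ[r,s] 𝐫 𝐬) 32 tt 0 32 refl λ ())

polyC-degree : HasTotalDegree polyC 32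
polyC-degree = formC⇒polyC (λ p → HasTotalDegree p 32)
  (hasTotalDegree (Forms.formC ℤ[r,s] 𝐫 𝐬) 32 tt 28 4 refl λ ())

-- Identities between the forms

syntaxRing : ℕ → RawRing _ _
syntaxRing n = record
  { Carrier = Expr ℤ n
  ; _≈_ = _≡_
  ; _+_ = _⊕_
  ; _*_ = _⊗_
  ; -_ = ⊝_
  ; 0# = Κ 0ℤ
  ; 1# = Κ 1ℤ
  }

⟦⟧-isHom : ∀ {n} (ρ : Vec ℤ n) → IsHom (syntaxRing n) (λ e → ⟦ e ⟧ ρ)
⟦⟧-isHom {n} ρ = isHom (syntaxRing n) (cong (λ e → ⟦ e ⟧ ρ))
  (λ _ _ → refl) (λ _ _ → refl) (λ _ → refl) refl refl

-- A record, since checking a type norm e₁ ≡ norm e₂ against itself may evaluate norm.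
infix 4 _≐_
record _≐_ {n} (e₁ e₂ : Expr ℤ n) : Set where
  constructor normal
  field norm≡norm : norm e₁ ≡ norm e₂

≐⇒≡ : ∀ {n} {e₁ e₂ : Expr ℤ n} → e₁ ≐ e₂ → ∀ ρ → ⟦ e₁ ⟧ ρ ≡ ⟦ e₂ ⟧ ρ
≐⇒≡ {e₁ = e₁} {e₂} (normal eq) ρ = prove ρ e₁ e₂ (cong (λ p → ⟦ p ⟧ₚ ρ) eq)

𝑟 𝑠 : Expr ℤ 2
𝑟 = Ι Fin.zero
𝑠 = Ι (Fin.suc Fin.zero)

open Forms (syntaxRing 2) 𝑟 𝑠 using (_-_)
open RawSemiringDefs (RawRing.rawSemiring (syntaxRing 2)) using (_^_) renaming (_×_ to _·_)

p₆ p₈ p₁₂ formA formB formC : Expr ℤ 2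
p₆ = Forms.p₆ (syntaxRing 2) 𝑟 𝑠
p₈ = Forms.p₈ (syntaxRing 2) 𝑟 𝑠
p₁₂ = Forms.p₁₂ (syntaxRing 2) 𝑟 𝑠
formA = Forms.formA (syntaxRing 2) 𝑟 𝑠
formB = Forms.formB (syntaxRing 2) 𝑟 𝑠
formC = Forms.formC (syntaxRing 2) 𝑟 𝑠

-- p₁₂ = f² + g²
w f g q ab+bc+ca-root abc-root : Expr ℤ 2
w = 𝑟 ^ 2 ⊕ 𝑠 ^ 2
f = 𝑟 ^ 6 - 5 · (𝑟 ^ 4 ⊗ 𝑠 ^ 2) - 𝑟 ^ 2 ⊗ 𝑠 ^ 4 ⊕ 𝑠 ^ 6
g = 4 · (𝑟 ⊗ 𝑠 ⊗ w ^ 2)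
q = 𝑟 ^ 16 ⊕ 18 · (𝑟 ^ 14 ⊗ 𝑠 ^ 2) ⊕ 16 · (𝑟 ^ 12 ⊗ 𝑠 ^ 4) ⊕ 150 · (𝑟 ^ 10 ⊗ 𝑠 ^ 6) ⊕ 222 · (𝑟 ^ 8 ⊗ 𝑠 ^ 8)
    ⊕ 142 · (𝑟 ^ 6 ⊗ 𝑠 ^ 10) ⊕ 48 · (𝑟 ^ 4 ⊗ 𝑠 ^ 12) ⊕ 10 · (𝑟 ^ 2 ⊗ 𝑠 ^ 14) ⊕ 𝑠 ^ 16
ab+bc+ca-root = 𝑟 ⊗ 𝑠 ⊗ w ^ 2 ⊗ p₆ ⊗ p₈ ⊗ p₁₂
abc-root = 2 · (𝑟 ^ 3 ⊗ 𝑠 ^ 3 ⊗ w ⊗ p₆ ^ 2 ⊗ p₈ ^ 2 ⊗ p₁₂)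

sum-≐ : formA ⊕ formB ⊕ formC ≐ q ⊗ q
sum-≐ = normal refl

sum₂-≐ : formA ⊗ formB ⊕ formB ⊗ formC ⊕ formC ⊗ formA ≐ ab+bc+ca-root ⊗ ab+bc+ca-root
sum₂-≐ = normal refl

product-≐ : formA ⊗ formB ⊗ formC ≐ abc-root ⊗ abc-root
product-≐ = normal refl

-- The decomposition of formA is w p₁₂ = (s f + r g)² + (r f - s g)² times (r p₈)²,
-- where s f + r g happens to be s p₆.
a₁ a₂ b₂ c₁ c₂ : Expr ℤ 2
a₁ = 𝑟 ⊗ 𝑠 ⊗ p₆ ⊗ p₈
a₂ = 𝑟 ⊗ p₈ ⊗ (𝑟 ⊗ f - 𝑠 ⊗ g)
b₂ = 𝑠 ^ 2 ⊗ p₆ ⊗ p₈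
c₁ = Κ (+ 8) ⊗ 𝑟 ⊗ 𝑟 ⊗ 𝑟 ⊗ 𝑠 ⊗ 𝑠 ⊗ 𝑠 ⊗ p₆ ⊗ w ⊗ w
c₂ = 2 · (𝑟 ^ 2 ⊗ 𝑠 ^ 2 ⊗ p₆ ⊗ f)

formA-≐ : formA ≐ a₁ ⊗ a₁ ⊕ a₂ ⊗ a₂
formA-≐ = normal refl

formB-≐ : formB ≐ a₁ ⊗ a₁ ⊕ b₂ ⊗ b₂
formB-≐ = normal refl

formC-≐ : formC ≐ c₁ ⊗ c₁ ⊕ c₂ ⊗ c₂
formC-≐ = normal refl

at : ℤ → ℤ → Vec ℤ 2
at r s = r ∷ s ∷ []

-- Anisotropic forms

infix 4 _≡_[mod_]
_≡_[mod_] : ℤ → ℤ → ℤ → Set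
i ≡ j [mod m ] = m ∣ i + - j

module _ {m : ℤ} where
  mod-refl : ∀ i → i ≡ i [mod m ]
  mod-refl i = divides 0ℤ (ℤ.+-inverseʳ i)

  mod-+ : ∀ i j k l → i ≡ j [mod m ] → k ≡ l [mod m ] → i + k ≡ j + l [mod m ]
  mod-+ i j k l p q = subst (m ∣_) (rearrange i j k l) (∣m∣n⇒∣m+n p q)
    where
    rearrange : ∀ i j k l → (i + - j) + (k + - l) ≡ (i + k) + - (j + l)
    rearrange = solve-∀

  mod-* : ∀ i j k l → i ≡ j [mod m ] → k ≡ l [mod m ] → i * k ≡ j * l [mod m ]
  mod-* i j k l p q = subst (m ∣_) (rearrange i j k l) (∣m∣n⇒∣m+n (∣m⇒∣m*n k p) (∣n⇒∣m*n j q))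
    where
    rearrange : ∀ i j k l → (i + - j) * k + j * (k + - l) ≡ i * k + - (j * l)
    rearrange = solve-∀

  mod-neg : ∀ i j → i ≡ j [mod m ] → - i ≡ - j [mod m ]
  mod-neg i j p = subst (m ∣_) (rearrange i j) (∣m⇒∣-m p)
    where
    rearrange : ∀ i j → - (i + - j) ≡ - i + - (- j)
    rearrange = solve-∀

  mod-^ : ∀ i j n → i ≡ j [mod m ] → i ^′ n ≡ j ^′ n [mod m ]
  mod-^ i j zero          p = mod-refl 1ℤ
  mod-^ i j (suc zero)    p = p
  mod-^ i j (suc (suc n)) p = mod-* (i ^′ suc n) (j ^′ suc n) i j (mod-^ i j (suc n) p) p

  mod-⟦⟧ : ∀ {n} (e : Expr ℤ n) (ρ σ : Vec ℤ n) → (∀ x → lookup ρ x ≡ lookup σ x [mod m ]) →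
           ⟦ e ⟧ ρ ≡ ⟦ e ⟧ σ [mod m ]
  mod-⟦⟧ (Κ k)     ρ σ ρ≡σ = mod-refl k
  mod-⟦⟧ (Ι x)     ρ σ ρ≡σ = ρ≡σ x
  mod-⟦⟧ (e₁ ⊕ e₂) ρ σ ρ≡σ = mod-+ (⟦ e₁ ⟧ ρ) (⟦ e₁ ⟧ σ) (⟦ e₂ ⟧ ρ) (⟦ e₂ ⟧ σ) (mod-⟦⟧ e₁ ρ σ ρ≡σ) (mod-⟦⟧ e₂ ρ σ ρ≡σ)
  mod-⟦⟧ (e₁ ⊗ e₂) ρ σ ρ≡σ = mod-* (⟦ e₁ ⟧ ρ) (⟦ e₁ ⟧ σ) (⟦ e₂ ⟧ ρ) (⟦ e₂ ⟧ σ) (mod-⟦⟧ e₁ ρ σ ρ≡σ) (mod-⟦⟧ e₂ ρ σ ρ≡σ)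
  mod-⟦⟧ (e ⊛ n)   ρ σ ρ≡σ = mod-^ (⟦ e ⟧ ρ) (⟦ e ⟧ σ) n (mod-⟦⟧ e ρ σ ρ≡σ)
  mod-⟦⟧ (⊝ e)     ρ σ ρ≡σ = mod-neg (⟦ e ⟧ ρ) (⟦ e ⟧ σ) (mod-⟦⟧ e ρ σ ρ≡σ)

scale : ∀ {n} → ℤ → Expr ℤ n → Expr ℤ n
scale m (Κ k)     = Κ k
scale m (Ι x)     = Ι x ⊗ Κ m
scale m (e₁ ⊕ e₂) = scale m e₁ ⊕ scale m e₂
scale m (e₁ ⊗ e₂) = scale m e₁ ⊗ scale m e₂
scale m (e ⊛ n)   = scale m e ⊛ n
scale m (⊝ e)     = ⊝ scale m e

⟦scale⟧ : ∀ {n} m (e : Expr ℤ n) (ρ : Vec ℤ n) → ⟦ scale m e ⟧ ρ ≡ ⟦ e ⟧ (Vec.map (_* m) ρ)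
⟦scale⟧ m (Κ k)     ρ = refl
⟦scale⟧ m (Ι x)     ρ = sym (lookup-map x (_* m) ρ)
⟦scale⟧ m (e₁ ⊕ e₂) ρ = cong₂ _+_ (⟦scale⟧ m e₁ ρ) (⟦scale⟧ m e₂ ρ)
⟦scale⟧ m (e₁ ⊗ e₂) ρ = cong₂ _*_ (⟦scale⟧ m e₁ ρ) (⟦scale⟧ m e₂ ρ)
⟦scale⟧ m (e ⊛ n)   ρ = cong (_^′ n) (⟦scale⟧ m e ρ)
⟦scale⟧ m (⊝ e)     ρ = cong -_ (⟦scale⟧ m e ρ)

ZeroAt : ∀ m → Expr ℤ 2 → Fin m → Fin m → Set
ZeroAt m e x y = + m ∣ ⟦ e ⟧ (at (+ Fin.toℕ x) (+ Fin.toℕ y))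

AnisotropicMod : ℕ → Expr ℤ 2 → Set
AnisotropicMod m e = ∀ x y → ZeroAt m e x y → Fin.toℕ x ≡ 0 × Fin.toℕ y ≡ 0

anisotropicMod? : ∀ m e → Dec (AnisotropicMod m e)
anisotropicMod? m e = Fin.all? λ x → Fin.all? λ y →
  (+ m ∣? ⟦ e ⟧ (at (+ Fin.toℕ x) (+ Fin.toℕ y))) →-dec (Fin.toℕ x ℕ.≟ 0 ×-dec Fin.toℕ y ℕ.≟ 0)

module _ (m : ℕ) .{{m≢0 : ℕ.NonZero m}} (1<m : 1 ℕ.< m) (e : Expr ℤ 2) (e-aniso : AnisotropicMod m e)
         (k : ℤ) (k≢0 : k ≢ 0ℤ) (e-homogeneous : scale (+ m) e ≐ Κ k ⊗ e) where

  private
    residue : ℤ → Fin m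
    residue i = Fin.fromℕ< (n%ℕd<d i m)

    toℕ-residue : ∀ i → Fin.toℕ (residue i) ≡ i %ℕ m
    toℕ-residue i = Fin.toℕ-fromℕ< (n%ℕd<d i m)

    residue-≡ : ∀ i → + Fin.toℕ (residue i) ≡ i [mod + m ]
    residue-≡ i = divides (- (i /ℕ m)) (begin
      + Fin.toℕ (residue i) + - i                            ≡⟨ cong (λ x → + x + - i) (toℕ-residue i) ⟩
      + (i %ℕ m) + - i                                       ≡⟨ cong (λ x → + (i %ℕ m) + - x) (a≡a%ℕn+[a/ℕn]*n i m) ⟩
      + (i %ℕ m) + - (+ (i %ℕ m) + (i /ℕ m) * + m)           ≡⟨ rearrange (+ (i %ℕ m)) (i /ℕ m) (+ m) ⟩
      - (i /ℕ m) * + m                                       ∎)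
      where
      open ≡-Reasoning
      rearrange : ∀ x y z → x + - (x + y * z) ≡ - y * z
      rearrange = solve-∀

    quotient-≡ : ∀ i → Fin.toℕ (residue i) ≡ 0 → i ≡ (i /ℕ m) * + m
    quotient-≡ i i%m≡0 = begin
      i                                ≡⟨ a≡a%ℕn+[a/ℕn]*n i m ⟩
      + (i %ℕ m) + (i /ℕ m) * + m      ≡⟨ cong (λ x → + x + (i /ℕ m) * + m) (trans (sym (toℕ-residue i)) i%m≡0) ⟩
      0ℤ + (i /ℕ m) * + m              ≡⟨ ℤ.+-identityˡ _ ⟩
      (i /ℕ m) * + m                   ∎
      where open ≡-Reasoning

    divisible : ∀ i j → ⟦ e ⟧ (at i j) ≡ 0ℤ →
                i ≡ (i /ℕ m) * + m × j ≡ (j /ℕ m) * + m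
    divisible i j e≡0 = quotient-≡ i (proj₁ zeros) , quotient-≡ j (proj₂ zeros)
      where
      residues = at (+ Fin.toℕ (residue i)) (+ Fin.toℕ (residue j))

      congruent : ∀ x → lookup residues x ≡ lookup (at i j) x [mod + m ]
      congruent Fin.zero           = residue-≡ i
      congruent (Fin.suc Fin.zero) = residue-≡ j

      zero-mod : + m ∣ ⟦ e ⟧ residues
      zero-mod = subst (+ m ∣_) (ℤ.+-identityʳ _)
        (subst (λ x → + m ∣ ⟦ e ⟧ residues + - x) e≡0 (mod-⟦⟧ e residues (at i j) congruent))

      zeros = e-aniso (residue i) (residue j) zero-mod

    quotient-zero : ∀ i j → ⟦ e ⟧ (at (i * + m) (j * + m)) ≡ 0ℤ → ⟦ e ⟧ (at i j) ≡ 0ℤ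
    quotient-zero i j e≡0 = [ ⊥-elim ∘ k≢0 , id ]′ (ℤ.i*j≡0⇒i≡0∨j≡0 k (begin
      k * ⟦ e ⟧ (at i j)               ≡⟨ ≐⇒≡ e-homogeneous (at i j) ⟨
      ⟦ scale (+ m) e ⟧ (at i j)       ≡⟨ ⟦scale⟧ (+ m) e (at i j) ⟩
      ⟦ e ⟧ (at (i * + m) (j * + m))   ≡⟨ e≡0 ⟩
      0ℤ                               ∎))
      where open ≡-Reasoning

    descent : ∀ i j → ⟦ e ⟧ (at i j) ≡ 0ℤ → Acc ℕ._<_ ∣ i ∣ → i ≡ 0ℤ
    descent i j e≡0 (acc smaller) with i ≟ 0ℤ
    ... | yes i≡0 = i≡0
    ... | no  i≢0 = trans (proj₁ (divisible i j e≡0)) (cong (_* + m) (descent i′ j′ e′≡0 (smaller ∣i′∣<∣i∣)))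
      where
      i′ = i /ℕ m
      j′ = j /ℕ m

      e′≡0 : ⟦ e ⟧ (at i′ j′) ≡ 0ℤ
      e′≡0 = quotient-zero i′ j′
        (subst₂ (λ x y → ⟦ e ⟧ (at x y) ≡ 0ℤ) (proj₁ (divisible i j e≡0)) (proj₂ (divisible i j e≡0)) e≡0)

      ∣i∣≡∣i′∣*m : ∣ i ∣ ≡ ∣ i′ ∣ ℕ.* m
      ∣i∣≡∣i′∣*m = trans (cong ∣_∣ (proj₁ (divisible i j e≡0))) (ℤ.abs-* i′ (+ m))

      ∣i′∣≢0 : ∣ i′ ∣ ≢ 0
      ∣i′∣≢0 ∣i′∣≡0 = i≢0 (ℤ.∣i∣≡0⇒i≡0 (trans ∣i∣≡∣i′∣*m (cong (ℕ._* m) ∣i′∣≡0)))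

      ∣i′∣<∣i∣ : ∣ i′ ∣ ℕ.< ∣ i ∣
      ∣i′∣<∣i∣ = subst (∣ i′ ∣ ℕ.<_) (sym ∣i∣≡∣i′∣*m) (ℕ.m<m*n ∣ i′ ∣ m {{ℕ.≢-nonZero ∣i′∣≢0}} 1<m)

  anisotropic : ∀ i j → i ≢ 0ℤ → ⟦ e ⟧ (at i j) ≢ 0ℤ
  anisotropic i j i≢0 e≡0 = i≢0 (descent i j e≡0 (<-wellFounded ∣ i ∣))

module _ (r s : ℤ) (r≢0 : r ≢ 0ℤ) where
  w≢0 : ⟦ w ⟧ (at r s) ≢ 0ℤ
  w≢0 = anisotropic 7 (ℕ.s≤s (ℕ.s≤s ℕ.z≤n)) w (toWitness {a? = anisotropicMod? 7 w} tt)
    (+ (7 ℕ.^ 2)) (λ ()) (normal refl) r s r≢0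

  p₆≢0 : ⟦ p₆ ⟧ (at r s) ≢ 0ℤ
  p₆≢0 = anisotropic 7 (ℕ.s≤s (ℕ.s≤s ℕ.z≤n)) p₆ (toWitness {a? = anisotropicMod? 7 p₆} tt)
    (+ (7 ℕ.^ 6)) (λ ()) (normal refl) r s r≢0

  p₈≢0 : ⟦ p₈ ⟧ (at r s) ≢ 0ℤ
  p₈≢0 = anisotropic 7 (ℕ.s≤s (ℕ.s≤s ℕ.z≤n)) p₈ (toWitness {a? = anisotropicMod? 7 p₈} tt)
    (+ (7 ℕ.^ 8)) (λ ()) (normal refl) r s r≢0

-- Squares and sums of two squares

/5≢0 : ∀ i → i ≢ 0ℤ → i ℚ./ 5 ≢ 0ℚ
/5≢0 i i≢0 i/5≡0 = i≢0 (trans (sym (ℤ.*-identityʳ i)) (ℚᵘ.drop-*≡* i/5≃0))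
  where
  i/5≃0 : mkℚᵘ i 4 ≃ mkℚᵘ 0ℤ 0
  i/5≃0 = ℚᵘ.≃-trans (ℚᵘ.≃-sym (ℚ.toℚᵘ-fromℚᵘ (mkℚᵘ i 4))) (ℚᵘ.≃-reflexive (cong toℚᵘ i/5≡0))

fifths : ∀ n x y → x ≢ 0ℤ → y ≢ 0ℤ → n * + 25 ≡ x * x + y * y → SumOfTwoNonzeroSquares n
fifths n x y x≢0 y≢0 25n≡x²+y² = x ℚ./ 5 , y ℚ./ 5 , /5≢0 x x≢0 , /5≢0 y y≢0 , ℚ.toℚᵘ-injective (begin
  toℚᵘ (n ℚ./ 1)                                     ≈⟨ ℚ.toℚᵘ-fromℚᵘ (mkℚᵘ n 0) ⟩
  mkℚᵘ n 0                                           ≈⟨ *≡* cross-multiplied ⟩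
  mkℚᵘ x 4 ℚᵘ.* mkℚᵘ x 4 ℚᵘ.+ mkℚᵘ y 4 ℚᵘ.* mkℚᵘ y 4 ≈⟨ ℚᵘ.+-cong (square x) (square y) ⟨
  toℚᵘ (x ℚ./ 5 ℚ.* (x ℚ./ 5)) ℚᵘ.+ toℚᵘ (y ℚ./ 5 ℚ.* (y ℚ./ 5))
                                                     ≈⟨ ℚ.toℚᵘ-homo-+ (x ℚ./ 5 ℚ.* (x ℚ./ 5)) (y ℚ./ 5 ℚ.* (y ℚ./ 5)) ⟨
  toℚᵘ (x ℚ./ 5 ℚ.* (x ℚ./ 5) ℚ.+ y ℚ./ 5 ℚ.* (y ℚ./ 5)) ∎)
  where
  open import Relation.Binary.Reasoning.Setoid ℚᵘ.≃-setoid

  square : ∀ i → toℚᵘ (i ℚ./ 5 ℚ.* (i ℚ./ 5)) ≃ mkℚᵘ i 4 ℚᵘ.* mkℚᵘ i 4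
  square i = ℚᵘ.≃-trans (ℚ.toℚᵘ-homo-* (i ℚ./ 5) (i ℚ./ 5))
    (ℚᵘ.*-cong (ℚ.toℚᵘ-fromℚᵘ (mkℚᵘ i 4)) (ℚ.toℚᵘ-fromℚᵘ (mkℚᵘ i 4)))

  cross-multiplied : n * + 625 ≡ (x * x * + 25 + y * y * + 25) * + 1
  cross-multiplied = trans (lhs n) (trans (cong (_* + 25) 25n≡x²+y²) (rhs x y))
    where
    lhs : ∀ n → n * + 625 ≡ n * + 25 * + 25
    lhs = solve-∀
    rhs : ∀ x y → (x * x + y * y) * + 25 ≡ (x * x * + 25 + y * y * + 25) * + 1
    rhs = solve-∀

*-≢0 : ∀ i j → i ≢ 0ℤ → j ≢ 0ℤ → i * j ≢ 0ℤ
*-≢0 i j i≢0 j≢0 ij≡0 = [ i≢0 , j≢0 ]′ (ℤ.i*j≡0⇒i≡0∨j≡0 i ij≡0)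

sumOfTwoNonzeroSquares : ∀ n x y → n ≡ x * x + y * y → x ≢ 0ℤ → SumOfTwoNonzeroSquares n
sumOfTwoNonzeroSquares n x y n≡x²+y² x≢0 with y ≟ 0ℤ
... | yes refl = fifths n (+ 3 * x) (+ 4 * x) (*-≢0 (+ 3) x (λ ()) x≢0) (*-≢0 (+ 4) x (λ ()) x≢0)
                   (trans (cong (_* + 25) n≡x²+y²) (pythagorean x))
  where
  pythagorean : ∀ x → (x * x + 0ℤ) * + 25 ≡ + 3 * x * (+ 3 * x) + + 4 * x * (+ 4 * x)
  pythagorean = solve-∀
... | no y≢0 = fifths n (+ 5 * x) (+ 5 * y) (*-≢0 (+ 5) x (λ ()) x≢0) (*-≢0 (+ 5) y (λ ()) y≢0)
                   (trans (cong (_* + 25) n≡x²+y²) (scaled x y))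
  where
  scaled : ∀ x y → (x * x + y * y) * + 25 ≡ + 5 * x * (+ 5 * x) + + 5 * y * (+ 5 * y)
  scaled = solve-∀

module _ (r s : ℤ) where
  private
    open FormsHom (syntaxRing 2) (⟦⟧-isHom (at r s))

    A : formA ↦ a r s
    A = formA-homo 𝑟 𝑠 {r} {s} refl refl

    B : formB ↦ b r s
    B = formB-homo 𝑟 𝑠 {r} {s} refl refl

    C : formC ↦ c r s
    C = formC-homo 𝑟 𝑠 {r} {s} refl refl

    isSquare : ∀ {e y n} → e ≐ y ⊗ y → e ↦ n → IsSquare +-*-rawRing n
    isSquare {y = y} e≡y² e↦n = ⟦ y ⟧ (at r s) , trans (sym (image e↦n)) (≐⇒≡ e≡y² (at r s))

  sum-isSquare : IsSquare +-*-rawRing (a r s + b r s + c r s)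
  sum-isSquare = isSquare sum-≐ (A ⟨+⟩ B ⟨+⟩ C)

  sum₂-isSquare : IsSquare +-*-rawRing (a r s * b r s + b r s * c r s + c r s * a r s)
  sum₂-isSquare = isSquare sum₂-≐ (A ⟨*⟩ B ⟨+⟩ B ⟨*⟩ C ⟨+⟩ C ⟨*⟩ A)

  product-isSquare : IsSquare +-*-rawRing (a r s * b r s * c r s)
  product-isSquare = isSquare product-≐ (A ⟨*⟩ B ⟨*⟩ C)

  module _ (r≢0 : r ≢ 0ℤ) (s≢0 : s ≢ 0ℤ) where
    private
      infix 4 _≢0′
      record _≢0′ (e : Expr ℤ 2) : Set where
        constructor nz
        field value≢0 : ⟦ e ⟧ (at r s) ≢ 0ℤ

      infixl 7 _⟨⊗⟩_
      _⟨⊗⟩_ : ∀ {e₁ e₂} → e₁ ≢0′ → e₂ ≢0′ → e₁ ⊗ e₂ ≢0′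
      _⟨⊗⟩_ {e₁} {e₂} (nz p) (nz q) = nz (*-≢0 (⟦ e₁ ⟧ (at r s)) (⟦ e₂ ⟧ (at r s)) p q)

      r′ : 𝑟 ≢0′
      r′ = nz r≢0

      s′ : 𝑠 ≢0′
      s′ = nz s≢0

      w′ : w ≢0′
      w′ = nz (w≢0 r s r≢0)

      p₆′ : p₆ ≢0′
      p₆′ = nz (p₆≢0 r s r≢0)

      p₈′ : p₈ ≢0′
      p₈′ = nz (p₈≢0 r s r≢0)

      a₁≢0 : a₁ ≢0′
      a₁≢0 = r′ ⟨⊗⟩ s′ ⟨⊗⟩ p₆′ ⟨⊗⟩ p₈′

      c₁≢0 : c₁ ≢0′
      c₁≢0 = nz {Κ (+ 8)} (λ ()) ⟨⊗⟩ r′ ⟨⊗⟩ r′ ⟨⊗⟩ r′ ⟨⊗⟩ s′ ⟨⊗⟩ s′ ⟨⊗⟩ s′ ⟨⊗⟩ p₆′ ⟨⊗⟩ w′ ⟨⊗⟩ w′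

      isSum : ∀ {e x y n} → e ≐ x ⊗ x ⊕ y ⊗ y → e ↦ n → x ≢0′ → SumOfTwoNonzeroSquares n
      isSum {x = x} {y} {n} e≡x²+y² e↦n (nz x≢0) = sumOfTwoNonzeroSquares n (⟦ x ⟧ (at r s)) (⟦ y ⟧ (at r s))
        (trans (sym (image e↦n)) (≐⇒≡ e≡x²+y² (at r s))) x≢0

    a-isSum : SumOfTwoNonzeroSquares (a r s)
    a-isSum = isSum formA-≐ A a₁≢0

    b-isSum : SumOfTwoNonzeroSquares (b r s)
    b-isSum = isSum formB-≐ B a₁≢0

    c-isSum : SumOfTwoNonzeroSquares (c r s)
    c-isSum = isSum formC-≐ C c₁≢0

mainTheorem4 : (∀ (r s : ℤ) →
    IsSquare +-*-rawRing (a r s + b r s + c r s) ×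
    IsSquare +-*-rawRing (a r s * b r s + b r s * c r s + c r s * a r s) ×
    IsSquare +-*-rawRing (a r s * b r s * c r s))
    ×
    (∀ (r s : ℤ) →
    a r s ≡ eval₂ polyA r s × b r s ≡ eval₂ polyB r s × c r s ≡ eval₂ polyC r s)
    ×
    (HasTotalDegree polyA 32 × HasTotalDegree polyB 32 × HasTotalDegree polyC 32)
    ×
    (¬ IsSquare ℤ[r,s] polyA × ¬ IsSquare ℤ[r,s] polyB × ¬ IsSquare ℤ[r,s] polyC)
    ×
    (∀ (r s : ℤ) → r ≢ 0ℤ → s ≢ 0ℤ →
    SumOfTwoNonzeroSquares (a r s) × SumOfTwoNonzeroSquares (b r s) × SumOfTwoNonzeroSquares (c r s))
mainTheorem4 =
  (λ r s → sum-isSquare r s , sum₂-isSquare r s , product-isSquare r s) ,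
  (λ r s → sym (eval₂-polyA r s) , sym (eval₂-polyB r s) , sym (eval₂-polyC r s)) ,
  (polyA-degree , polyB-degree , polyC-degree) ,
  (polyA-nonsquare , polyB-nonsquare , polyC-nonsquare) ,
  (λ r s r≢0 s≢0 → a-isSum r s r≢0 s≢0 , b-isSum r s r≢0 s≢0 , c-isSum r s r≢0 s≢0)
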